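{- Let $r$ and $n$ be positive integers. If $k=\left(1-\frac1r+\frac1{r!}\right)r!$, then $f(n,r,k)\ge n/r!$. It follows that the linear path threshold is at most $\left(1-\frac1r+\frac1{r!}\right)r!$.
   Context: An $r$-digraph $G$ consists of a finite vertex set $V(G)$ and an edge set $E(G)$ whose elements are ordered lists of $r$ distinct vertices. An $(r,k)$-tournament ($0\le k\le r!$) is an $r$-digraph $G$ such that for every $r$-element set $S\subseteq V(G)$, exactly $k$ of the $r!$ orderings of $S$ are edges of $G$. The tight path $P^{(r)}_s$ is the $r$-digraph with $s$ distinct vertices $v_1,\ldots,v_s$ whose edges are exactly the lists of $r$ consecutive vertices $(v_i,\ldots,v_{i+r-1})$, $1\le i\le s-r+1$ (no edges if $s<r$). An $r$-digraph $G$ contains $P^{(r)}_s$ if there is an injection of its vertices into $V(G)$ mapping edges to edges. $f(n,r,k)$ is the maximum integer $s$ such that every $n$-vertex $(r,k)$-tournament contains a copy of $P^{(r)}_s$. For fixed $r$, the linear path threshold is the minimum $k$ such that $f(n,r,k)$ is linear in $n$, i.e. $f(n,r,k)=\Omega(n)$ as $n\to\infty$. -}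

module Defs where

open import Data.Bool.Base using (Bool; true; false)
import Data.Bool.Properties as Bool
open import Data.Fin.Base as Fin using (Fin; zero; suc; toℕ; fromℕ<)
import Data.Fin.Properties as Fin
open import Data.Fin.Subset using (Subset; inside; outside; ∣_∣; ⁅_⁆; _∪_; ⊥)
  renaming (_∈_ to _∈ₛ_; _∉_ to _∉ₛ_)
import Data.Fin.Subset.Properties as Subset
open import Data.Integer.Base using (+_)
open import Data.List.Base as List
  using (List; []; _∷_; _++_; length; filter; concatMap; allFin; cartesianProductWith)
open import Data.List.Membership.Propositional using (_∈_; find; lose)
open import Data.List.Membership.Propositional.Properties
open import Data.List.Membership.Propositional.Properties.WithK using (unique∧set⇒bag)
import Data.List.Properties as List
open import Data.List.Relation.Binary.BagAndSetEquality using (∼bag⇒↭)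
open import Data.List.Relation.Binary.Permutation.Propositional.Properties using (↭-length)
open import Data.List.Relation.Unary.All as All using (All; []; _∷_)
import Data.List.Relation.Unary.AllPairs as AllPairs
open import Data.List.Relation.Unary.Any as Any using (here; there)
open import Data.List.Relation.Unary.Unique.Propositional using (Unique; []; _∷_)
import Data.List.Relation.Unary.Unique.Propositional.Properties as Unique
open import Data.Nat.Base hiding (_/_)
open import Data.Nat.Properties as ℕ using (_!≢0)
open import Data.Product.Base using (∃-syntax; _×_; _,_; proj₁; proj₂)
open import Data.Rational.Base as ℚ using (ℚ; 0ℚ; 1ℚ; _/_)
open import Data.Sum.Base using (inj₁; inj₂)
open import Data.Vec.Base as Vec using (Vec; []; _∷_; there; tabulate; lookup)
import Data.Vec.Properties as Vec
import Data.Vec.Relation.Unary.All as VecAll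
import Data.Vec.Relation.Unary.All.Properties as VecAll
import Data.Vec.Relation.Unary.AllPairs as VecAllPairs
import Data.Vec.Relation.Unary.Unique.Propositional as Vec using (Unique)
import Data.Vec.Relation.Unary.Unique.Propositional.Properties as VecUnique
open import Function.Base using (_∘_; case_of_)
open import Function.Bundles using (mk⇔)
open import Function.Definitions using (Injective)
open import Level using (0ℓ)
open import Relation.Binary.Definitions using (DecidableEquality)
open import Relation.Binary.PropositionalEquality
open import Relation.Nullary
open import Relation.Nullary.Decidable using (map′; _→-dec_; _×-dec_; ¬?)
open import Relation.Unary using (Pred; Decidable)

private
  variable
    A B : Set
    n r s k m : ℕ

record Digraph (r n : ℕ) : Set where
  field
    edges    : List (Vec (Fin n) r)
    simple   : Unique edges
    distinct : All Vec.Unique edges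

open Digraph public

support : Vec (Fin n) r → Subset n
support []       = ⊥
support (v ∷ vs) = ⁅ v ⁆ ∪ support vs

infix 4 _≟ₛ_

_≟ₛ_ : DecidableEquality (Subset n)
_≟ₛ_ = Vec.≡-dec Bool._≟_

-- The entries of an edge are distinct, so for ∣ S ∣ ≡ r the edges with
-- support S are exactly the orderings of S that are edges.

edgesOn : Digraph r n → Subset n → List (Vec (Fin n) r)
edgesOn G S = filter (λ e → support e ≟ₛ S) (edges G)

IsTournament : ℕ → Digraph r n → Set
IsTournament {r} {n} k G = (S : Subset n) → ∣ S ∣ ≡ r → length (edgesOn G S) ≡ k

_Contains_ : Digraph r n → Digraph r s → Set
_Contains_ {n = n} {s = s} G H =
  ∃[ φ ] Injective {A = Fin s} {B = Fin n} _≡_ _≡_ φ ×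
         (∀ {e} → e ∈ edges H → Vec.map φ e ∈ edges G)

window-bound : ∀ r s (i : Fin (suc s ∸ r)) (j : Fin r) → toℕ i + toℕ j < s
window-bound r s i j = begin-strict
  toℕ i + toℕ j  <⟨ ℕ.+-monoʳ-< (toℕ i) (Fin.toℕ<n j) ⟩
  toℕ i + r      ≤⟨ s≤s⁻¹ (ℕ.m≤o∸n⇒m+n≤o (suc (toℕ i)) r≤1+s (Fin.toℕ<n i)) ⟩
  s              ∎
  where
  open ℕ.≤-Reasoning
  r≤1+s : r ≤ suc s
  r≤1+s = ℕ.<⇒≤ (ℕ.m∸n≢0⇒n<m λ eq → case subst Fin eq i of λ ())

-- Truncated subtraction makes the index set empty for s < r.

window : ∀ r s → Fin (suc s ∸ r) → Vec (Fin s) r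
window r s i = tabulate λ j → fromℕ< (window-bound r s i j)

window-injective : ∀ r .{{_ : NonZero r}} s {i j} → window r s i ≡ window r s j → i ≡ j
window-injective r@(suc _) s {i} {j} eq = Fin.toℕ-injective (ℕ.+-cancelʳ-≡ 0 _ _ (begin
  toℕ i + 0                                     ≡⟨ Fin.toℕ-fromℕ< (window-bound r s i zero) ⟨
  toℕ (fromℕ< (window-bound r s i zero))        ≡⟨ cong (toℕ ∘ Vec.head) eq ⟩
  toℕ (fromℕ< (window-bound r s j zero))        ≡⟨ Fin.toℕ-fromℕ< (window-bound r s j zero) ⟩
  toℕ j + 0                                     ∎))
  where open ≡-Reasoning

window-distinct : ∀ r s i → Vec.Unique (window r s i)
window-distinct r s i = VecUnique.tabulate⁺ λ {j} {l} eq →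
  Fin.toℕ-injective (ℕ.+-cancelˡ-≡ (toℕ i) _ _
    (Fin.fromℕ<-injective _ _ (window-bound r s i j) (window-bound r s i l) eq))

tightPath : ∀ r .{{_ : NonZero r}} s → Digraph r s
tightPath r s = record
  { edges    = List.tabulate (window r s)
  ; simple   = Unique.tabulate⁺ (window-injective r s)
  ; distinct = All.tabulate λ e∈ → case ∈-tabulate⁻ e∈ of λ where
      (i , refl) → window-distinct r s i
  }

EveryTournamentContainsPath : (n r k : ℕ) .{{_ : NonZero r}} → ℕ → Set
EveryTournamentContainsPath n r k s =
  (G : Digraph r n) → IsTournament k G → G Contains tightPath r s

IsMaximum IsMinimum : Pred ℕ 0ℓ → Pred ℕ 0ℓ
IsMaximum P m = P m × (∀ {i} → P i → i ≤ m)
IsMinimum P m = P m × (∀ {i} → P i → m ≤ i)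

vecs : List A → ∀ r → List (Vec A r)
vecs xs zero    = [] ∷ []
vecs xs (suc r) = cartesianProductWith _∷_ xs (vecs xs r)

∈-vecs : {xs : List A} → (∀ x → x ∈ xs) → (v : Vec A r) → v ∈ vecs xs r
∈-vecs all []      = here refl
∈-vecs all (x ∷ v) = ∈-cartesianProductWith⁺ _∷_ (all x) (∈-vecs all v)

vecs-unique : {xs : List A} → Unique xs → ∀ r → Unique (vecs xs r)
vecs-unique u zero    = [] ∷ []
vecs-unique u (suc r) = Unique.cartesianProductWith⁺ _∷_ Vec.∷-injective u (vecs-unique u r)

sublists : List A → List (List A)
sublists []       = [] ∷ []
sublists (x ∷ xs) = List.map (x ∷_) (sublists xs) ++ sublists xs

filter-∈-sublists : {P : Pred A 0ℓ} (P? : Decidable P) →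
                    ∀ xs → filter P? xs ∈ sublists xs
filter-∈-sublists P? []       = here refl
filter-∈-sublists P? (x ∷ xs) with does (P? x)
... | true  = ∈-++⁺ˡ (∈-map⁺ (x ∷_) (filter-∈-sublists P? xs))
... | false = ∈-++⁺ʳ _ (filter-∈-sublists P? xs)

unique-length : {xs ys : List A} → Unique xs → Unique ys →
                (∀ {v} → v ∈ xs → v ∈ ys) → (∀ {v} → v ∈ ys → v ∈ xs) →
                length xs ≡ length ys
unique-length u u′ f g = ↭-length (∼bag⇒↭ (unique∧set⇒bag u u′ (mk⇔ f g)))

_≟ᵥ_ : DecidableEquality (Vec (Fin n) r)
_≟ᵥ_ = Vec.≡-dec Fin._≟_

_∈?_ : (e : Vec (Fin n) r) (es : List (Vec (Fin n) r)) → Dec (e ∈ es)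
e ∈? es = Any.any? (e ≟ᵥ_) es

isTournament? : ∀ k (G : Digraph r n) → Dec (IsTournament k G)
isTournament? {r} k G = map′
  (λ all S → All.lookup all (∈-vecs ∈-bools S)) (λ t → All.tabulate λ {S} _ → t S)
  (All.all? (λ S → (∣ S ∣ ℕ.≟ r) →-dec (length (edgesOn G S) ℕ.≟ k)) (vecs bools _))
  where
  bools : List Bool
  bools = true ∷ false ∷ []
  ∈-bools : ∀ b → b ∈ bools
  ∈-bools true  = here refl
  ∈-bools false = there (here refl)

contains? : (G : Digraph r n) (H : Digraph r s) → Dec (G Contains H)
contains? {r} {n} {s} G H = map′ to from (Any.any? copy? (vecs (allFin n) s))
  where
  Copy : Vec (Fin n) s → Set
  Copy φ = Vec.Unique φ × All (λ e → Vec.map (lookup φ) e ∈ edges G) (edges H)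

  copy? : Decidable Copy
  copy? φ = VecAllPairs.allPairs? (λ x y → ¬? (x Fin.≟ y)) φ ×-dec
            All.all? (λ e → Vec.map (lookup φ) e ∈? edges G) (edges H)

  to : Any.Any Copy (vecs (allFin n) s) → G Contains H
  to p = let φ , _ , inj , hom = find p in
    lookup φ , VecUnique.lookup-injective inj _ _ , All.lookup hom

  from : G Contains H → Any.Any Copy (vecs (allFin n) s)
  from (φ , inj , hom) = lose (∈-vecs ∈-allFin (tabulate φ))
    ( VecUnique.tabulate⁺ inj
    , All.tabulate λ {e} e∈ →
        subst (_∈ edges G) (Vec.map-cong (λ i → sym (Vec.lookup∘tabulate φ i)) e) (hom e∈))

everyTournamentContainsPath? : (n r k : ℕ) .{{_ : NonZero r}} →
                               Decidable (EveryTournamentContainsPath n r k)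
everyTournamentContainsPath? n r k s = map′ to from (All.all? good? (sublists all))
  where
  all = vecs (allFin n) r

  Good : List (Vec (Fin n) r) → Set
  Good es = (u : Unique es) (d : All Vec.Unique es) →
            let G = record { edges = es ; simple = u ; distinct = d } in
            IsTournament k G → G Contains tightPath r s

  good? : Decidable Good
  good? es with AllPairs.allPairs? (λ x y → ¬? (x ≟ᵥ y)) es
              | All.all? (VecAllPairs.allPairs? (λ x y → ¬? (x Fin.≟ y))) es
  ... | no ¬u | _     = yes λ u → contradiction u ¬u
  ... | yes _ | no ¬d = yes λ _ d → contradiction d ¬d
  ... | yes u | yes d = let G = record { edges = es ; simple = u ; distinct = d } in
    map′ (λ h _ _ → h) (λ h → h u d) (isTournament? k G →-dec contains? G (tightPath r s))

  from : EveryTournamentContainsPath n r k s → All Good (sublists all)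
  from h = All.tabulate λ {es} _ u d → h record { edges = es ; simple = u ; distinct = d }

  to : All Good (sublists all) → EveryTournamentContainsPath n r k s
  to h G t = let φ , inj , hom = All.lookup h (filter-∈-sublists (_∈? edges G) all)
                                   (Unique.filter⁺ (_∈? edges G) (vecs-unique (Unique.allFin⁺ n) r))
                                   (All.tabulate (All.lookup (distinct G) ∘ sound))
                                   t′
             in φ , inj , sound ∘ hom
    where
    sound : ∀ {e} → e ∈ filter (_∈? edges G) all → e ∈ edges G
    sound = proj₂ ∘ ∈-filter⁻ (_∈? edges G) {xs = all}
    complete : ∀ {e} → e ∈ edges G → e ∈ filter (_∈? edges G) all
    complete = ∈-filter⁺ (_∈? edges G) (∈-vecs ∈-allFin _)
    t′ = λ S ∣S∣≡r → let S? = λ e → support e ≟ₛ S in trans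
      (unique-length
        (Unique.filter⁺ S? (Unique.filter⁺ (_∈? edges G) (vecs-unique (Unique.allFin⁺ n) r)))
        (Unique.filter⁺ S? (simple G))
        (λ e∈ → let e∈′ , eq = ∈-filter⁻ S? {xs = filter (_∈? edges G) all} e∈
                in ∈-filter⁺ S? (sound e∈′) eq)
        (λ e∈ → let e∈′ , eq = ∈-filter⁻ S? {xs = edges G} e∈ in ∈-filter⁺ S? (complete e∈′) eq))
      (t S ∣S∣≡r)

largest : {P : Pred ℕ 0ℓ} → Decidable P → ℕ → ℕ
largest P? zero    = zero
largest P? (suc m) with P? (suc m)
... | yes _ = suc m
... | no  _ = largest P? m

-- A copy of a path on s vertices needs s ≤ n, so the search may stop at n;
-- f-isMaximum below shows that, for k ≤ r !, this is the maximum over all s.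

f : (n r k : ℕ) .{{_ : NonZero r}} → ℕ
f n r k = largest (everyTournamentContainsPath? n r k) n

-- Ω(n); a rational constant c > 0 is no loss over a real one.

IsLinear : (ℕ → ℕ) → Set
IsLinear g = ∃[ c ] 0ℚ ℚ.< c × ∃[ N ] ∀ n → N ≤ n → c ℚ.* (+ n / 1) ℚ.≤ + g n / 1

-- A relation rather than a function: linearity of f is not decidable, so
-- constructively a least such k can only be shown to exist up to ¬ ¬.

IsLinearPathThreshold : (r : ℕ) .{{_ : NonZero r}} → ℕ → Set
IsLinearPathThreshold r = IsMinimum λ k → k ≤ r ! × IsLinear λ n → f n r k

[1-1/r+1/r!]r! : (r : ℕ) .{{_ : NonZero r}} → ℚ
[1-1/r+1/r!]r! r = (1ℚ ℚ.- + 1 / r ℚ.+ + 1 / r !) ℚ.* (+ (r !) / 1)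
  where instance _ = r !≢0

∣⁅x⁆∪p∣≤1+∣p∣ : ∀ (x : Fin n) p → ∣ ⁅ x ⁆ ∪ p ∣ ≤ suc ∣ p ∣
∣⁅x⁆∪p∣≤1+∣p∣ zero    (inside  ∷ p) rewrite Subset.∪-identityˡ p = s≤s (ℕ.n≤1+n _)
∣⁅x⁆∪p∣≤1+∣p∣ zero    (outside ∷ p) rewrite Subset.∪-identityˡ p = ℕ.≤-refl
∣⁅x⁆∪p∣≤1+∣p∣ (suc x) (inside  ∷ p) = s≤s (∣⁅x⁆∪p∣≤1+∣p∣ x p)
∣⁅x⁆∪p∣≤1+∣p∣ (suc x) (outside ∷ p) = ∣⁅x⁆∪p∣≤1+∣p∣ x p

x∈p⇒⁅x⁆∪p≡p : ∀ {x : Fin n} {p} → x ∈ₛ p → ⁅ x ⁆ ∪ p ≡ p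
x∈p⇒⁅x⁆∪p≡p {x = zero}  {inside ∷ p} x∈p         = cong (inside ∷_) (Subset.∪-identityˡ p)
x∈p⇒⁅x⁆∪p≡p {x = suc x} {s ∷ p}      (there x∈p) = cong (s ∷_) (x∈p⇒⁅x⁆∪p≡p x∈p)

∣support∣≤ : (vs : Vec (Fin n) r) → ∣ support vs ∣ ≤ r
∣support∣≤ {n} []  = ℕ.≤-reflexive (Subset.∣⊥∣≡0 n)
∣support∣≤ (v ∷ vs) = ℕ.≤-trans (∣⁅x⁆∪p∣≤1+∣p∣ v (support vs)) (s≤s (∣support∣≤ vs))

∉-support : ∀ {v : Fin n} {vs : Vec (Fin n) r} → v ∉ₛ support vs → VecAll.All (v ≢_) vs
∉-support {vs = []}     v∉ = VecAll.[]
∉-support {vs = w ∷ vs} v∉ =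
  (λ { refl → v∉ (Subset.x∈p∪q⁺ (inj₁ (Subset.x∈⁅x⁆ _))) }) VecAll.∷
  ∉-support (v∉ ∘ Subset.x∈p∪q⁺ ∘ inj₂)

∉-support⁻ : ∀ {v : Fin n} {vs : Vec (Fin n) r} → VecAll.All (v ≢_) vs → v ∉ₛ support vs
∉-support⁻ {vs = []}     _                  v∈ = Subset.∉⊥ v∈
∉-support⁻ {vs = w ∷ vs} (v≢w VecAll.∷ v≢s) v∈ = case Subset.x∈p∪q⁻ ⁅ w ⁆ _ v∈ of λ where
  (inj₁ v∈w) → v≢w (Subset.x∈⁅y⁆⇒x≡y w v∈w)
  (inj₂ v∈s) → ∉-support⁻ v≢s v∈s

full-support⇒unique : (vs : Vec (Fin n) r) → ∣ support vs ∣ ≡ r → Vec.Unique vs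
full-support⇒unique []       _  = VecAllPairs.[]
full-support⇒unique {r = suc r} (v ∷ vs) eq =
  ∉-support v∉ VecAllPairs.∷
  full-support⇒unique vs (ℕ.≤-antisym (∣support∣≤ vs)
    (s≤s⁻¹ (subst (_≤ suc ∣ support vs ∣) eq (∣⁅x⁆∪p∣≤1+∣p∣ v (support vs)))))
  where
  v∉ : v ∉ₛ support vs
  v∉ v∈ = ℕ.1+n≰n (subst (_≤ r) (trans (cong ∣_∣ (sym (x∈p⇒⁅x⁆∪p≡p v∈))) eq) (∣support∣≤ vs))

elements : (S : Subset n) → Vec (Fin n) ∣ S ∣
elements []            = []
elements (inside  ∷ S) = zero ∷ Vec.map suc (elements S)
elements (outside ∷ S) = Vec.map suc (elements S)

support-map-suc : (vs : Vec (Fin n) r) → support (Vec.map suc vs) ≡ outside ∷ support vs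
support-map-suc []       = refl
support-map-suc (v ∷ vs) = cong (⁅ suc v ⁆ ∪_) (support-map-suc vs)

support-elements : (S : Subset n) → support (elements S) ≡ S
support-elements []            = refl
support-elements (outside ∷ S) =
  trans (support-map-suc (elements S)) (cong (outside ∷_) (support-elements S))
support-elements (inside  ∷ S) =
  trans (cong (⁅ zero ⁆ ∪_) (support-map-suc (elements S)))
        (cong (inside ∷_) (trans (Subset.∪-identityˡ _) (support-elements S)))

concatMap-unique : (g : A → List B) → ∀ {xs} → Unique xs → (∀ {x} → x ∈ xs → Unique (g x)) →
                   (∀ {x y v} → x ∈ xs → y ∈ xs → v ∈ g x → v ∈ g y → x ≡ y) →
                   Unique (concatMap g xs)
concatMap-unique g []       _ _   = []
concatMap-unique g {x ∷ xs} (x∉ ∷ u) h inj = Unique.++⁺ (h (here refl))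
  (concatMap-unique g u (h ∘ there) (λ p q → inj (there p) (there q)))
  λ (v∈gx , v∈) → let y , y∈ , v∈gy = find (∈-concatMap⁻ g v∈) in
    All.lookup x∉ y∈ (inj (here refl) (there y∈) v∈gx v∈gy)

length-concatMap : (g : A → List B) → (∀ x → length (g x) ≡ m) →
                   ∀ xs → length (concatMap g xs) ≡ length xs * m
length-concatMap g eq []       = refl
length-concatMap g eq (x ∷ xs) =
  trans (List.length-++ (g x)) (cong₂ _+_ (eq x) (length-concatMap g eq xs))

insertions : A → Vec A m → List (Vec A (suc m))
insertions x []       = (x ∷ []) ∷ []
insertions x (y ∷ ys) = (x ∷ y ∷ ys) ∷ List.map (y ∷_) (insertions x ys)

permutations : Vec A m → List (Vec A m)
permutations []       = [] ∷ []
permutations (x ∷ xs) = concatMap (insertions x) (permutations xs)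

length-insertions : (x : A) (ys : Vec A m) → length (insertions x ys) ≡ suc m
length-insertions x []       = refl
length-insertions x (y ∷ ys) =
  cong suc (trans (List.length-map _ (insertions x ys)) (length-insertions x ys))

length-permutations : (xs : Vec A m) → length (permutations xs) ≡ m !
length-permutations []               = refl
length-permutations {m = suc m} (x ∷ xs) = begin
  length (permutations (x ∷ xs))   ≡⟨ length-concatMap _ (length-insertions x) (permutations xs) ⟩
  length (permutations xs) * suc m ≡⟨ cong (_* suc m) (length-permutations xs) ⟩
  m ! * suc m                      ≡⟨ ℕ.*-comm (m !) (suc m) ⟩
  suc m !                          ∎
  where open ≡-Reasoning

insertions-support : ∀ (x : Fin n) (ys : Vec (Fin n) m) {e} → e ∈ insertions x ys →
                     support e ≡ ⁅ x ⁆ ∪ support ys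
insertions-support x []       (here refl) = refl
insertions-support x (y ∷ ys) (here refl) = refl
insertions-support x (y ∷ ys) (there e∈)  with e , e∈′ , refl ← ∈-map⁻ (y ∷_) e∈ = begin
  ⁅ y ⁆ ∪ support e             ≡⟨ cong (⁅ y ⁆ ∪_) (insertions-support x ys e∈′) ⟩
  ⁅ y ⁆ ∪ (⁅ x ⁆ ∪ support ys)  ≡⟨ Subset.∪-assoc ⁅ y ⁆ ⁅ x ⁆ (support ys) ⟨
  (⁅ y ⁆ ∪ ⁅ x ⁆) ∪ support ys  ≡⟨ cong (_∪ support ys) (Subset.∪-comm ⁅ y ⁆ ⁅ x ⁆) ⟩
  (⁅ x ⁆ ∪ ⁅ y ⁆) ∪ support ys  ≡⟨ Subset.∪-assoc ⁅ x ⁆ ⁅ y ⁆ (support ys) ⟩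
  ⁅ x ⁆ ∪ (⁅ y ⁆ ∪ support ys)  ∎
  where open ≡-Reasoning

permutations-support : ∀ (xs : Vec (Fin n) m) {e} → e ∈ permutations xs → support e ≡ support xs
permutations-support []       (here refl) = refl
permutations-support (x ∷ xs) e∈ =
  let ys , ys∈ , e∈′ = find (∈-concatMap⁻ (insertions x) {xs = permutations xs} e∈) in
  trans (insertions-support x ys e∈′) (cong (⁅ x ⁆ ∪_) (permutations-support xs ys∈))

insertions-unique : ∀ {x : A} {ys : Vec A m} → VecAll.All (x ≢_) ys → Unique (insertions x ys)
insertions-unique VecAll.[]            = [] ∷ []
insertions-unique (x≢y VecAll.∷ x∉ys) =
  All.tabulate (λ e∈ → case ∈-map⁻ (_ ∷_) e∈ of λ { (_ , _ , refl) refl → x≢y refl })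
  ∷ Unique.map⁺ Vec.∷-injectiveʳ (insertions-unique x∉ys)

insertions-injective : ∀ {x : A} {ys zs : Vec A m} {e} →
                       VecAll.All (x ≢_) ys → VecAll.All (x ≢_) zs →
                       e ∈ insertions x ys → e ∈ insertions x zs → ys ≡ zs
insertions-injective VecAll.[] VecAll.[] _ _ = refl
insertions-injective (_ VecAll.∷ _) (_ VecAll.∷ _) (here refl) (here refl) = refl
insertions-injective (_ VecAll.∷ _) (x≢z VecAll.∷ _) (here refl) (there e∈)
  with _ , _ , refl ← ∈-map⁻ (_ ∷_) e∈ = contradiction refl x≢z
insertions-injective (x≢y VecAll.∷ _) (_ VecAll.∷ _) (there e∈) (here refl)
  with _ , _ , refl ← ∈-map⁻ (_ ∷_) e∈ = contradiction refl x≢y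
insertions-injective (_ VecAll.∷ x∉ys) (_ VecAll.∷ x∉zs) (there e∈) (there e∈′)
  with _ , p , refl ← ∈-map⁻ (_ ∷_) e∈ | _ , q , refl ← ∈-map⁻ (_ ∷_) e∈′
  = cong (_ ∷_) (insertions-injective x∉ys x∉zs p q)

permutations-unique : ∀ {xs : Vec (Fin n) m} → Vec.Unique xs → Unique (permutations xs)
permutations-unique VecAllPairs.[]                   = [] ∷ []
permutations-unique {xs = x ∷ xs} (x∉ VecAllPairs.∷ u) =
  concatMap-unique (insertions x) (permutations-unique u) (insertions-unique ∘ x∉′)
    (λ p q → insertions-injective (x∉′ p) (x∉′ q))
  where
  x∉′ : ∀ {ys} → ys ∈ permutations xs → VecAll.All (x ≢_) ys
  x∉′ ys∈ = ∉-support (subst (x ∉ₛ_) (sym (permutations-support xs ys∈)) (∉-support⁻ x∉))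

∈-take⁻ : ∀ k {xs : List A} {x} → x ∈ List.take k xs → x ∈ xs
∈-take⁻ (suc k) {_ ∷ _} (here eq)  = here eq
∈-take⁻ (suc k) {_ ∷ _} (there x∈) = there (∈-take⁻ k x∈)

orderings : ∀ r → Subset n → List (Vec (Fin n) r)
orderings r S with ∣ S ∣ ℕ.≟ r
... | yes refl = permutations (elements S)
... | no  _    = []

orderings-support : ∀ (S : Subset n) {e : Vec (Fin n) r} → e ∈ orderings r S → support e ≡ S
orderings-support {r = r} S e∈ with ∣ S ∣ ℕ.≟ r
... | yes refl = trans (permutations-support (elements S) e∈) (support-elements S)

orderings-card : ∀ (S : Subset n) {e : Vec (Fin n) r} → e ∈ orderings r S → ∣ S ∣ ≡ r
orderings-card {r = r} S e∈ with ∣ S ∣ ℕ.≟ r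
... | yes eq = eq

orderings-unique : ∀ r (S : Subset n) → Unique (orderings r S)
orderings-unique r S with ∣ S ∣ ℕ.≟ r
... | yes refl = permutations-unique
                   (full-support⇒unique (elements S) (cong ∣_∣ (support-elements S)))
... | no  _    = []

length-orderings : ∀ (S : Subset n) → ∣ S ∣ ≡ r → length (orderings r S) ≡ r !
length-orderings {r = r} S eq with ∣ S ∣ ℕ.≟ r
... | yes refl = length-permutations (elements S)
... | no  ∣S∣≢r = contradiction eq ∣S∣≢r

module _ (n r k : ℕ) (k≤r! : k ≤ r !) where

  private
    g : Subset n → List (Vec (Fin n) r)
    g S = List.take k (orderings r S)

    subsets : List (Subset n)
    subsets = vecs (true ∷ false ∷ []) n

    subsets-unique : Unique subsets
    subsets-unique = vecs-unique (((λ ()) ∷ []) ∷ [] ∷ []) n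

    ∈-subsets : ∀ S → S ∈ subsets
    ∈-subsets = ∈-vecs λ { true → here refl ; false → there (here refl) }

    g-support : ∀ S {e} → e ∈ g S → support e ≡ S
    g-support S e∈ = orderings-support S (∈-take⁻ k e∈)

    es : List (Vec (Fin n) r)
    es = concatMap g subsets

    es-unique : Unique es
    es-unique = concatMap-unique g subsets-unique
      (λ {S} _ → Unique.take⁺ k (orderings-unique r S))
      (λ {S} {T} _ _ p q → trans (sym (g-support S p)) (g-support T q))

    es-distinct : All Vec.Unique es
    es-distinct = All.tabulate λ {e} e∈ →
      let S , _ , e∈gS = find (∈-concatMap⁻ g {xs = subsets} e∈)
      in full-support⇒unique e
           (trans (cong ∣_∣ (g-support S e∈gS)) (orderings-card S (∈-take⁻ k e∈gS)))

  someTournament : Digraph r n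
  someTournament = record { edges = es ; simple = es-unique ; distinct = es-distinct }

  someTournament-isTournament : IsTournament k someTournament
  someTournament-isTournament S ∣S∣≡r = begin
    length (edgesOn someTournament S)  ≡⟨ unique-length (Unique.filter⁺ S? es-unique)
                                            (Unique.take⁺ k (orderings-unique r S)) to from ⟩
    length (g S)                       ≡⟨ List.length-take k (orderings r S) ⟩
    k ⊓ length (orderings r S)         ≡⟨ cong (k ⊓_) (length-orderings S ∣S∣≡r) ⟩
    k ⊓ r !                            ≡⟨ ℕ.m≤n⇒m⊓n≡m k≤r! ⟩
    k                                  ∎
    where
    open ≡-Reasoning
    S? = λ (e : Vec (Fin n) r) → support e ≟ₛ S
    to : ∀ {e} → e ∈ filter S? es → e ∈ g S
    to {e} e∈ =
      let e∈′ , eq    = ∈-filter⁻ S? {xs = es} e∈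
          T , _ , e∈T = find (∈-concatMap⁻ g {xs = subsets} e∈′)
      in subst (λ U → e ∈ g U) (trans (sym (g-support T e∈T)) eq) e∈T
    from : ∀ {e} → e ∈ g S → e ∈ filter S? es
    from e∈ = ∈-filter⁺ S? (∈-concatMap⁺ g (lose (∈-subsets S) e∈)) (g-support S e∈)

containsEmptyPath : ∀ n r k .{{_ : NonZero r}} → EveryTournamentContainsPath n r k 0
containsEmptyPath n r@(suc r-1) k G _ = (λ ()) , (λ { {()} }) , λ e∈ →
  let i , _ = ∈-tabulate⁻ e∈
  in case subst Fin (ℕ.0∸n≡0 r-1) i of λ ()

largest-sat : {P : Pred ℕ 0ℓ} (P? : Decidable P) → P 0 → ∀ m → P (largest P? m)
largest-sat P? p0 zero    = p0
largest-sat P? p0 (suc m) with P? (suc m)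
... | yes p = p
... | no  _ = largest-sat P? p0 m

largest-max : {P : Pred ℕ 0ℓ} (P? : Decidable P) → ∀ m {i} → i ≤ m → P i → i ≤ largest P? m
largest-max P? zero    i≤m p = i≤m
largest-max P? (suc m) i≤m p with P? (suc m)
... | yes _  = i≤m
... | no  ¬p = largest-max P? m (s≤s⁻¹ (ℕ.≤∧≢⇒< i≤m λ { refl → ¬p p })) p

f-isMaximum : ∀ n r k .{{_ : NonZero r}} → k ≤ r ! →
              IsMaximum (EveryTournamentContainsPath n r k) (f n r k)
f-isMaximum n r k k≤r! =
    largest-sat path? (containsEmptyPath n r k) n
  , λ h → let φ , inj , _ = h (someTournament n r k k≤r!) (someTournament-isTournament n r k k≤r!)
          in largest-max path? n (Fin.injective⇒≤ inj) h
  where path? = everyTournamentContainsPath? n r k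

{-# OPTIONS --safe #-}

-- Write r = q + 1, so that k = r! − q! + 1. A set of r vertices has q! cyclic orders and misses
-- fewer than q! edges, so some cyclic order of it has all its r rotations as edges. Call such
-- edges cyclic: they form a rotation-closed family with at least n(n−1)⋯(n−q)/q! members. While
-- some q-tuple is the tail of at least one but at most t remaining edges, delete these edges with
-- all their rotations; a tuple dies at most once, at a cost of at most rt edges, so for
-- t r! < n − q something survives. Now every surviving tail has more than t surviving
-- extensions, so a path with q + l vertices, l ≤ t, can be extended at the front by a new vertex,
-- and q + t + 1 ≥ n / r! for the largest such t.

module Submission where

open import Defs
open import Data.Nat.Base as ℕ using (ℕ; zero; suc; NonZero; _!; _+_; _*_; _∸_; _<_; z≤n; s≤s; s≤s⁻¹; z<s; s<s; pred; >-nonZero; >-nonZero⁻¹)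
  renaming (_≤_ to _≤ₙ_)
open import Data.Nat.Properties as ℕ using (_!≢0)
open import Data.Nat.DivMod using (m/n*n≤m; m%n<n; m≡m%n+[m/n]*n)
import Data.Nat.Induction as ℕ
open import Data.Nat.GeneralisedArithmetic using (iterate)
open import Data.Fin.Base as Fin using (Fin; toℕ; fromℕ<)
import Data.Fin.Properties as Fin
open import Data.Fin.Subset as Subset using (Subset; ∣_∣; ⁅_⁆; _∪_)
  renaming (_∈_ to _∈ₛ_; _∉_ to _∉ₛ_)
import Data.Fin.Subset.Properties as Subset
open import Data.Integer.Base as ℤ using (+_)
import Data.Integer.Properties as ℤ
open import Data.List.Base as List using (List; []; _∷_; _++_; length; filter; concatMap)
open import Data.List.Membership.Propositional using (_∈_; _∉_; find; lose)
open import Data.List.Membership.Propositional.Properties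
import Data.List.Properties as List
open import Data.List.Relation.Unary.All as All using (All; []; _∷_)
import Data.List.Relation.Unary.All.Properties as All
open import Data.List.Relation.Unary.Any as Any using (Any; here; there)
open import Data.List.Relation.Unary.Unique.Propositional using (Unique; []; _∷_)
import Data.List.Relation.Unary.Unique.Propositional.Properties as Unique
open import Data.Product.Base using (∃; ∃-syntax; _×_; _,_; proj₁; proj₂)
open import Data.Rational.Base as ℚ using (ℚ; 1ℚ; _/_; _≤_; toℚᵘ)
import Data.Rational.Properties as ℚ
open import Data.Rational.Solver using (module +-*-Solver)
open import Data.Rational.Unnormalised.Base as ℚᵘ using (mkℚᵘ; *≡*; *≤*)
import Data.Rational.Unnormalised.Properties as ℚᵘ
open import Data.Sum.Base using (inj₁; inj₂)
open import Data.Vec.Base as Vec using (Vec; []; _∷_; _∷ʳ_; toList)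
import Data.Vec.Properties as Vec
import Data.Vec.Relation.Unary.All as VecAll
import Data.Vec.Relation.Unary.All.Properties as VecAll
import Data.Vec.Relation.Unary.AllPairs as VecAllPairs
import Data.Vec.Relation.Unary.Any as VecAny
import Data.Vec.Membership.Propositional as Vec using (_∈_)
import Data.Vec.Membership.Propositional.Properties as Vec
import Data.Vec.Relation.Unary.Unique.Propositional as Vec using (Unique)
import Data.Vec.Relation.Unary.Unique.Propositional.Properties as VecUnique
open import Function.Base using (_∘_; case_of_)
open import Relation.Binary.PropositionalEquality
open import Level using (0ℓ)
open import Relation.Nullary
open import Relation.Nullary.Decidable using (¬?; decidable-stable)
open import Relation.Unary using (Pred)

private
  variable
    A B : Set
    m n : ℕ

-- Length estimates for lists

unique-⊆⇒length≤ : {xs ys : List A} → Unique xs → (∀ {v} → v ∈ xs → v ∈ ys) →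
                   length xs ≤ₙ length ys
unique-⊆⇒length≤ [] _ = z≤n
unique-⊆⇒length≤ {xs = x ∷ xs} (x∉ ∷ u) sub with as , bs , refl ← ∈-∃++ (sub (here refl)) = begin
  suc (length xs)               ≤⟨ s≤s (unique-⊆⇒length≤ u sub′) ⟩
  suc (length (as ++ bs))       ≡⟨ cong suc (List.length-++ as) ⟩
  suc (length as + length bs)   ≡⟨ ℕ.+-suc (length as) (length bs) ⟨
  length as + suc (length bs)   ≡⟨ List.length-++ as ⟨
  length (as ++ x ∷ bs)         ∎
  where
  open ℕ.≤-Reasoning
  sub′ : ∀ {v} → v ∈ xs → v ∈ as ++ bs
  sub′ v∈ with ∈-++⁻ as (sub (there v∈))
  ... | inj₁ v∈as          = ∈-++⁺ˡ v∈as
  ... | inj₂ (there v∈bs)  = ∈-++⁺ʳ as v∈bs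
  ... | inj₂ (here refl)   = contradiction refl (All.lookup x∉ v∈)

length-concatMap-≤ : ∀ {b} (g : A → List B) xs → (∀ {x} → x ∈ xs → length (g x) ≤ₙ b) →
                     length (concatMap g xs) ≤ₙ length xs * b
length-concatMap-≤ g []       _ = z≤n
length-concatMap-≤ g (x ∷ xs) h = ℕ.≤-trans (ℕ.≤-reflexive (List.length-++ (g x)))
  (ℕ.+-mono-≤ (h (here refl)) (length-concatMap-≤ g xs (h ∘ there)))

-- Rotations

iterate-+ : (g : A → A) (x : A) → ∀ i j → iterate g x (i + j) ≡ iterate g (iterate g x i) j
iterate-+ g x zero    j = refl
iterate-+ g x (suc i) j = iterate-+ g (g x) i j

rotateₗ : List A → List A
rotateₗ []       = []
rotateₗ (x ∷ xs) = xs ++ x ∷ []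

-- Stated for lists, where the two parts swap without a cast, and for an arbitrary split: `bs = []`
-- is a full turn, and a split before a chosen entry brings that entry to the front.
iterate-rotateₗ : (as bs : List A) → iterate rotateₗ (as ++ bs) (length as) ≡ bs ++ as
iterate-rotateₗ []       bs = sym (List.++-identityʳ bs)
iterate-rotateₗ (a ∷ as) bs = begin
  iterate rotateₗ ((as ++ bs) ++ a ∷ []) (length as)
    ≡⟨ cong (λ l → iterate rotateₗ l (length as)) (List.++-assoc as bs (a ∷ [])) ⟩
  iterate rotateₗ (as ++ bs ++ a ∷ []) (length as)    ≡⟨ iterate-rotateₗ as (bs ++ a ∷ []) ⟩
  (bs ++ a ∷ []) ++ as                                ≡⟨ List.++-assoc bs (a ∷ []) as ⟩
  bs ++ a ∷ as                                        ∎
  where open ≡-Reasoning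

rotate : Vec A n → Vec A n
rotate []       = []
rotate (x ∷ xs) = xs ∷ʳ x

toList-iterate-rotate : (e : Vec A n) → ∀ i →
                        toList (iterate rotate e i) ≡ iterate rotateₗ (toList e) i
toList-iterate-rotate e zero    = refl
toList-iterate-rotate e (suc i) = trans (toList-iterate-rotate (rotate e) i)
  (cong (λ l → iterate rotateₗ l i) (toList-rotate e))
  where
  toList-rotate : (e : Vec A n) → toList (rotate e) ≡ rotateₗ (toList e)
  toList-rotate []       = refl
  toList-rotate (x ∷ xs) = Vec.toList-∷ʳ x xs

iterate-rotate-period : (e : Vec A n) → iterate rotate e n ≡ e
iterate-rotate-period {n = n} e =
  trans (sym (Vec.cast-is-id refl _)) (Vec.toList-injective refl _ e (begin
    toList (iterate rotate e n)                      ≡⟨ toList-iterate-rotate e n ⟩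
    iterate rotateₗ (toList e) n
      ≡⟨ cong₂ (iterate rotateₗ) (List.++-identityʳ (toList e)) (Vec.length-toList e) ⟨
    iterate rotateₗ (toList e ++ []) (length (toList e))  ≡⟨ iterate-rotateₗ (toList e) [] ⟩
    toList e                                         ∎))
  where open ≡-Reasoning

rotations : Vec A n → List (Vec A n)
rotations {n = n} e = List.iterate rotate e n

∈-iterate⁺ : (g : A → A) (x : A) → ∀ {m i} → i < m → iterate g x i ∈ List.iterate g x m
∈-iterate⁺ g x {i = zero}  (s≤s _)   = here refl
∈-iterate⁺ g x {i = suc i} (s≤s i<m) = there (∈-iterate⁺ g (g x) i<m)

∈-iterate⁻ : (g : A → A) (x : A) → ∀ m {y} → y ∈ List.iterate g x m →
             ∃[ i ] i < m × y ≡ iterate g x i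
∈-iterate⁻ g x (suc m) (here refl) = 0 , z<s , refl
∈-iterate⁻ g x (suc m) (there y∈)  =
  let i , i<m , eq = ∈-iterate⁻ g (g x) m y∈ in suc i , s<s i<m , eq

iterate-suc : (g : A → A) (x : A) → ∀ i → iterate g x (suc i) ≡ g (iterate g x i)
iterate-suc g x zero    = refl
iterate-suc g x (suc i) = iterate-suc g (g x) i

∈-rotations-step : (e : Vec A (suc n)) {e′ : Vec A (suc n)} → e′ ∈ rotations e → rotate e′ ∈ rotations e
∈-rotations-step {n = n} e e′∈ with i , i<n , refl ← ∈-iterate⁻ rotate e (suc n) e′∈
  with ℕ.m≤n⇒m<n∨m≡n i<n
... | inj₁ i+1<n = subst (_∈ rotations e) (iterate-suc rotate e i) (∈-iterate⁺ rotate e i+1<n)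
-- At the last index one more step completes the full turn and gives back `e`, the head of
-- `rotations e`.
... | inj₂ refl  = subst (_∈ rotations e)
  (trans (sym (iterate-rotate-period e)) (iterate-suc rotate e i)) (here refl)

∈-rotations-iterate : (e : Vec A (suc n)) {e′ : Vec A (suc n)} → e′ ∈ rotations e →
                      ∀ i → iterate rotate e′ i ∈ rotations e
∈-rotations-iterate e e′∈ zero    = e′∈
∈-rotations-iterate e e′∈ (suc i) = ∈-rotations-iterate e (∈-rotations-step e e′∈) i

∈-rotations-trans : (e : Vec A (suc n)) {e′ e″ : Vec A (suc n)} →
                    e″ ∈ rotations e′ → e′ ∈ rotations e → e″ ∈ rotations e
∈-rotations-trans {n = n} e {e′} e″∈ e′∈ with i , _ , refl ← ∈-iterate⁻ rotate e′ (suc n) e″∈ =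
  ∈-rotations-iterate e e′∈ i

-- The `suc n ∸ i` steps missing from a full turn lead from the `i`-th rotation back to `e`.
∈-rotations-sym : (e : Vec A (suc n)) {e′ : Vec A (suc n)} → e′ ∈ rotations e → e ∈ rotations e′
∈-rotations-sym {n = n} e {e′} e′∈ with i , i<n , refl ← ∈-iterate⁻ rotate e (suc n) e′∈ =
  subst (_∈ rotations e′)
    (trans (sym (iterate-+ rotate e i (suc n ∸ i)))
      (trans (cong (iterate rotate e) (ℕ.m+[n∸m]≡n (ℕ.<⇒≤ i<n))) (iterate-rotate-period e)))
    (∈-rotations-iterate e′ (here refl) (suc n ∸ i))

-- Makes `insertions-support` apply to a single rotation step.
∷ʳ∈insertions : (x : A) (xs : Vec A n) → xs ∷ʳ x ∈ insertions x xs
∷ʳ∈insertions x []       = here refl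
∷ʳ∈insertions x (y ∷ ys) = there (∈-map⁺ (y ∷_) (∷ʳ∈insertions x ys))

support-rotations : ∀ {e e′ : Vec (Fin n) (suc m)} → e′ ∈ rotations e → support e′ ≡ support e
support-rotations {m = m} {e} e′∈ with i , _ , refl ← ∈-iterate⁻ rotate e (suc m) e′∈ = go e i
  where
  go : ∀ (e : Vec (Fin _) (suc m)) i → support (iterate rotate e i) ≡ support e
  go e        zero    = refl
  go (x ∷ xs) (suc i) = trans (go (xs ∷ʳ x) i) (insertions-support x xs (∷ʳ∈insertions x xs))

-- Orderings of a set

∣⁅x⁆∪p∣≡1+∣p∣ : ∀ (x : Fin n) p → x ∉ₛ p → ∣ ⁅ x ⁆ ∪ p ∣ ≡ suc ∣ p ∣
∣⁅x⁆∪p∣≡1+∣p∣ Fin.zero    (Subset.inside  ∷ p) x∉ = contradiction Vec.here x∉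
∣⁅x⁆∪p∣≡1+∣p∣ Fin.zero    (Subset.outside ∷ p) x∉ = cong (suc ∘ ∣_∣) (Subset.∪-identityˡ p)
∣⁅x⁆∪p∣≡1+∣p∣ (Fin.suc x) (Subset.inside  ∷ p) x∉ = cong suc (∣⁅x⁆∪p∣≡1+∣p∣ x p (x∉ ∘ Vec.there))
∣⁅x⁆∪p∣≡1+∣p∣ (Fin.suc x) (Subset.outside ∷ p) x∉ = ∣⁅x⁆∪p∣≡1+∣p∣ x p (x∉ ∘ Vec.there)

unique⇒full-support : {vs : Vec (Fin n) m} → Vec.Unique vs → ∣ support vs ∣ ≡ m
unique⇒full-support {n = n} VecAllPairs.[] = Subset.∣⊥∣≡0 n
unique⇒full-support {vs = v ∷ vs} (v∉ VecAllPairs.∷ u) =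
  trans (∣⁅x⁆∪p∣≡1+∣p∣ v (support vs) (∉-support⁻ v∉)) (cong suc (unique⇒full-support u))

-- Distinctness of `m` entries amounts to a support of size `m`, so it passes between vectors with
-- equal supports.
unique-support : {vs ws : Vec (Fin n) m} → support ws ≡ support vs → Vec.Unique vs → Vec.Unique ws
unique-support {ws = ws} eq u = full-support⇒unique ws (trans (cong ∣_∣ eq) (unique⇒full-support u))

∈-support⁻ : ∀ {v : Fin n} (vs : Vec (Fin n) m) → v ∈ₛ support vs → v Vec.∈ vs
∈-support⁻ []       v∈ = contradiction v∈ Subset.∉⊥
∈-support⁻ (w ∷ vs) v∈ with Subset.x∈p∪q⁻ ⁅ w ⁆ (support vs) v∈
... | inj₁ v∈w = VecAny.here (Subset.x∈⁅y⁆⇒x≡y w v∈w)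
... | inj₂ v∈s = VecAny.there (∈-support⁻ vs v∈s)

⁅x⁆∪-cancel : ∀ {x : Fin n} {p q} → x ∉ₛ p → x ∉ₛ q → ⁅ x ⁆ ∪ p ≡ ⁅ x ⁆ ∪ q → p ≡ q
⁅x⁆∪-cancel {x = x} x∉p x∉q eq =
  Subset.⊆-antisym (half x∉p eq) (half x∉q (sym eq))
  where
  half : ∀ {p q} → x ∉ₛ p → ⁅ x ⁆ ∪ p ≡ ⁅ x ⁆ ∪ q → ∀ {y} → y ∈ₛ p → y ∈ₛ q
  half {q = q} x∉p eq {y} y∈p
    with Subset.x∈p∪q⁻ ⁅ x ⁆ q (subst (y ∈ₛ_) eq (Subset.x∈p∪q⁺ (inj₂ y∈p)))
  ... | inj₂ y∈q = y∈q
  ... | inj₁ y∈x = contradiction (subst (_∈ₛ _) (Subset.x∈⁅y⁆⇒x≡y x y∈x) y∈p) x∉p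

∈⇒∈-insertions : ∀ {x : A} {ys : Vec A (suc m)} → x Vec.∈ ys → ∃[ zs ] ys ∈ insertions x zs
∈⇒∈-insertions {ys = y ∷ []}     (VecAny.here refl) = [] , here refl
∈⇒∈-insertions {ys = y ∷ z ∷ zs} (VecAny.here refl) = z ∷ zs , here refl
∈⇒∈-insertions {ys = y ∷ z ∷ zs} (VecAny.there x∈)  =
  let ws , p = ∈⇒∈-insertions x∈ in y ∷ ws , there (∈-map⁺ (y ∷_) p)

∈-permutations : {xs ys : Vec (Fin n) m} → Vec.Unique xs → support ys ≡ support xs →
                 ys ∈ permutations xs
∈-permutations {xs = []}     {[]} _ _ = here refl
∈-permutations {xs = x ∷ xs} {ys} u@(x∉ VecAllPairs.∷ uxs) eq
  with zs , ys∈ ← ∈⇒∈-insertions (∈-support⁻ ys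
         (subst (x ∈ₛ_) (sym eq) (Subset.x∈p∪q⁺ (inj₁ (Subset.x∈⁅x⁆ x)))))
  with eq′ ← trans (sym (insertions-support x zs ys∈)) eq
  -- `x ∷ zs` has the support of `x ∷ xs`, hence distinct entries; so `x` does not occur in `zs` and
  -- cancels from both supports.
  with x∉zs VecAllPairs.∷ _ ← unique-support {vs = x ∷ xs} {ws = x ∷ zs} eq′ u =
  ∈-concatMap⁺ (insertions x) (lose (∈-permutations uxs
    (⁅x⁆∪-cancel (∉-support⁻ x∉zs) (∉-support⁻ x∉) eq′)) ys∈)

-- Rotating past the entries before an occurrence of `v` suffices. Later this selects the ordering
-- with `v` in front as representative of its cyclic order.
rotate-to-front : ∀ {v : Fin n} (e : Vec (Fin n) (suc m)) → v ∈ₛ support e →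
                  ∃[ ys ] v ∷ ys ∈ rotations e
rotate-to-front {v = v} e v∈
  with as , bs , eq ← ∈-∃++ (Vec.∈-toList⁺ (∈-support⁻ e v∈))
  with iterate rotate e (length as) in req
     | trans (toList-iterate-rotate e (length as))
         (trans (cong (λ l → iterate rotateₗ l (length as)) eq) (iterate-rotateₗ as (v ∷ bs)))
... | w ∷ ys | eq′ with refl ← List.∷-injectiveˡ eq′ =
  ys , subst (_∈ rotations e) req (∈-rotations-iterate e (here refl) (length as))

-- Injective tuples

injections : ∀ m n → List (Vec (Fin n) m)
extensions : Vec (Fin n) m → List (Vec (Fin n) (suc m))

extensions x = List.map (_∷ x) (filter (λ v → ¬? (v Subset.∈? support x)) (List.allFin _))

injections zero    n = [] ∷ []
injections (suc m) n = concatMap extensions (injections m n)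

∈-extensions⁻ : ∀ {x : Vec (Fin n) m} {e} → e ∈ extensions x → ∃[ v ] v ∉ₛ support x × e ≡ v ∷ x
∈-extensions⁻ {x = x} e∈ with v , v∈ , refl ← ∈-map⁻ (_∷ x) e∈ =
  v , proj₂ (∈-filter⁻ (λ v → ¬? (v Subset.∈? support x)) {xs = List.allFin _} v∈) , refl

injections-unique : ∀ m n → Unique (injections m n)
injections-unique zero    n = [] ∷ []
injections-unique (suc m) n = concatMap-unique extensions (injections-unique m n)
  (λ {x} _ → Unique.map⁺ Vec.∷-injectiveˡ
    (Unique.filter⁺ (λ v → ¬? (v Subset.∈? support x)) (Unique.allFin⁺ n)))
  λ _ _ p q → case (∈-extensions⁻ p , ∈-extensions⁻ q) of λ where
    ((_ , _ , refl) , (_ , _ , refl)) → refl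

∈-injections⁺ : {x : Vec (Fin n) m} → Vec.Unique x → x ∈ injections m n
∈-injections⁺ {x = []}    _ = here refl
∈-injections⁺ {x = v ∷ x} (v∉ VecAllPairs.∷ u) = ∈-concatMap⁺ extensions
  (lose (∈-injections⁺ u)
    (∈-map⁺ (_∷ x) (∈-filter⁺ (λ v → ¬? (v Subset.∈? support x)) (∈-allFin v) (∉-support⁻ v∉))))

∈-injections⁻ : {x : Vec (Fin n) m} → x ∈ injections m n → Vec.Unique x
∈-injections⁻ {x = []}    _ = VecAllPairs.[]
∈-injections⁻ {x = v ∷ x} e∈ with y , y∈ , e∈y ← find (∈-concatMap⁻ extensions {xs = injections _ _} e∈)
  with _ , v∉ , refl ← ∈-extensions⁻ e∈y = ∉-support v∉ VecAllPairs.∷ ∈-injections⁻ y∈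

length-extensions : (x : Vec (Fin n) m) → n ∸ m ≤ₙ length (extensions x)
length-extensions {n} {m} x = ℕ.m≤n+o⇒m∸n≤o n m (begin
  n                                         ≡⟨ List.length-tabulate (λ i → i) ⟨
  length (List.allFin n)                    ≤⟨ unique-⊆⇒length≤ (Unique.allFin⁺ n) cover ⟩
  length (toList x ++ fresh)                ≡⟨ List.length-++ (toList x) ⟩
  length (toList x) + length fresh
    ≡⟨ cong₂ _+_ (Vec.length-toList x) (sym (List.length-map (_∷ x) fresh)) ⟩
  m + length (extensions x)                 ∎)
  where
  open ℕ.≤-Reasoning
  fresh : List (Fin n)
  fresh = filter (λ v → ¬? (v Subset.∈? support x)) (List.allFin n)
  cover : ∀ {v} → v ∈ List.allFin n → v ∈ toList x ++ fresh
  cover {v} v∈ with v Subset.∈? support x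
  ... | yes p = ∈-++⁺ˡ (Vec.∈-toList⁺ (∈-support⁻ x p))
  ... | no ¬p = ∈-++⁺ʳ (toList x) (∈-filter⁺ (λ v → ¬? (v Subset.∈? support x)) v∈ ¬p)

length-concatMap-≥ : ∀ {b} (g : A → List B) → (∀ x → b ≤ₙ length (g x)) →
                     ∀ xs → b * length xs ≤ₙ length (concatMap g xs)
length-concatMap-≥ {b = b} g h []       = ℕ.≤-reflexive (ℕ.*-zeroʳ b)
length-concatMap-≥ {b = b} g h (x ∷ xs) = begin
  b * suc (length xs)                        ≡⟨ ℕ.*-suc b (length xs) ⟩
  b + b * length xs                          ≤⟨ ℕ.+-mono-≤ (h x) (length-concatMap-≥ g h xs) ⟩
  length (g x) + length (concatMap g xs)     ≡⟨ List.length-++ (g x) ⟨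
  length (concatMap g (x ∷ xs))              ∎
  where open ℕ.≤-Reasoning

-- Relates tuples to their tails directly, so that the final estimate gets along without a product
-- formula for n(n-1)⋯(n-q).
length-injections-suc : ∀ m n → (n ∸ m) * length (injections m n) ≤ₙ length (injections (suc m) n)
length-injections-suc m n = length-concatMap-≥ extensions length-extensions (injections m n)

length-injections-pos : ∀ m n → m ≤ₙ n → 0 < length (injections m n)
length-injections-pos zero    n _   = z<s
length-injections-pos (suc m) n m<n = ℕ.≤-trans
  (ℕ.*-mono-≤ (ℕ.m<n⇒0<n∸m m<n) (length-injections-pos m n (ℕ.<⇒≤ m<n)))
  (length-injections-suc m n)

-- Pruning tails of small degree

Closed : List (Vec (Fin n) (suc m)) → Set
Closed H = ∀ {e e′} → e ∈ H → e′ ∈ rotations e → e′ ∈ H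

withTail : Vec (Fin n) m → List (Vec (Fin n) (suc m)) → List (Vec (Fin n) (suc m))
withTail x = filter λ e → Vec.tail e ≟ᵥ x

-- Induction on `k`, the number of tuples that may still be tails. A tuple of `A` that is the tail
-- of at most `t` edges is struck from `A`, and these edges are deleted with all their rotations;
-- the bound on `length H` pays for this. Once no such tuple is left, every tail lies in `A` and so
-- belongs to more than `t` edges.
prune : ∀ t k (A : List (Vec (Fin n) m)) (H : List (Vec (Fin n) (suc m))) → length A ≡ k →
        Unique H → Closed H → (∀ {e} → e ∈ H → Vec.tail e ∈ A) → t * suc m * k < length H →
        ∃[ H′ ] Unique H′ × Closed H′ × (∀ {e} → e ∈ H′ → e ∈ H) × 0 < length H′ ×
                (∀ {e} → e ∈ H′ → t < length (withTail (Vec.tail e) H′))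
prune t k A H ∣A∣ u c tails big with Any.any? (λ x → length (withTail x H) ℕ.≤? t) A
... | no ¬low = H , u , c , (λ e∈ → e∈) , ℕ.≤-<-trans z≤n big ,
                λ e∈ → ℕ.≰⇒> (λ low → ¬low (lose (tails e∈) low))
... | yes any with x , x∈ , low ← find any with as , bs , refl ← ∈-∃++ x∈
  with k | trans (sym ∣A∣) (trans (List.length-++ as) (ℕ.+-suc (length as) (length bs)))
... | zero | ()
... | suc k | ∣A∣≡ =
  let H″ , u″ , c″ , H″⊆ , rest = prune t k (as ++ bs) H′
        (trans (List.length-++ as) (ℕ.suc-injective (sym ∣A∣≡))) u′ c′ tails′ big′
  in H″ , u″ , c″ , proj₁ ∘ ∈-filter⁻ keep? {xs = H} ∘ H″⊆ , rest
  where
  D : List (Vec (Fin _) (suc _))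
  D = concatMap rotations (withTail x H)
  keep? = λ e → ¬? (e ∈? D)
  H′ = filter keep? H
  u′ : Unique H′
  u′ = Unique.filter⁺ keep? u
  -- `D` is a union of rotation classes: if `e′` is a rotation of a deleted edge, then so is `e`.
  c′ : Closed H′
  c′ {e} {e′} e∈ e′∈ with e∈H , e∉D ← ∈-filter⁻ keep? {xs = H} e∈ =
    ∈-filter⁺ keep? (c e∈H e′∈) λ e′∈D →
      let d , d∈ , e′∈d = find (∈-concatMap⁻ rotations {xs = withTail x H} e′∈D)
      in e∉D (∈-concatMap⁺ rotations
           (lose d∈ (∈-rotations-trans d (∈-rotations-sym e e′∈) e′∈d)))
  tails′ : ∀ {e} → e ∈ H′ → Vec.tail e ∈ as ++ bs
  tails′ {e} e∈ with e∈H , e∉D ← ∈-filter⁻ keep? {xs = H} e∈ with ∈-++⁻ as (tails e∈H)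
  ... | inj₁ p          = ∈-++⁺ˡ p
  ... | inj₂ (there p)  = ∈-++⁺ʳ as p
  -- An edge with tail `x` is one of its own rotations, hence already deleted.
  ... | inj₂ (here eq)  = contradiction
    (∈-concatMap⁺ rotations (lose (∈-filter⁺ (λ e → Vec.tail e ≟ᵥ x) e∈H eq) (here refl))) e∉D
  cover : ∀ {e} → e ∈ H → e ∈ D ++ H′
  cover {e} e∈ with e ∈? D
  ... | yes p = ∈-++⁺ˡ p
  ... | no ¬p = ∈-++⁺ʳ D (∈-filter⁺ keep? e∈ ¬p)
  -- One round costs at most `t` times the edge length, which is what the step from `suc k` to `k`
  -- takes off the bound.
  big′ : t * suc _ * k < length H′
  big′ = ℕ.+-cancelˡ-< (t * suc _) _ _ (begin-strict
    t * suc _ + t * suc _ * k     ≡⟨ ℕ.*-suc (t * suc _) k ⟨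
    t * suc _ * suc k             <⟨ big ⟩
    length H                      ≤⟨ unique-⊆⇒length≤ u cover ⟩
    length (D ++ H′)              ≡⟨ List.length-++ D ⟩
    length D + length H′
      ≤⟨ ℕ.+-monoˡ-≤ (length H′) (length-concatMap-≤ rotations (withTail x H)
           (λ {e} _ → ℕ.≤-reflexive (List.length-iterate rotate e (suc _)))) ⟩
    length (withTail x H) * suc _ + length H′
      ≤⟨ ℕ.+-monoˡ-≤ (length H′) (ℕ.*-monoˡ-≤ (suc _) low) ⟩
    t * suc _ + length H′         ∎)
    where open ℕ.≤-Reasoning

-- Extending paths

-- Sequences are total functions on the naturals of which only an initial segment matters; adding a
-- vertex in front or shifting a window then needs no casts.
push : A → (ℕ → A) → ℕ → A
push v p zero    = v
push v p (suc i) = p i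

initial : (ℕ → A) → ∀ m → Vec A m
initial p m = Vec.tabulate {n = m} (p ∘ toℕ)

initial-∷ʳ : (p : ℕ → A) → ∀ m → initial p (suc m) ≡ initial p m ∷ʳ p m
initial-∷ʳ p zero    = refl
initial-∷ʳ p (suc m) = cong (p 0 ∷_) (initial-∷ʳ (p ∘ suc) m)

lookupOr : A → Vec A m → ℕ → A
lookupOr d []       i       = d
lookupOr d (x ∷ xs) zero    = x
lookupOr d (x ∷ xs) (suc i) = lookupOr d xs i

initial-lookupOr : (d : A) (xs : Vec A m) → initial (lookupOr d xs) m ≡ xs
initial-lookupOr d []       = refl
initial-lookupOr d (x ∷ xs) = cong (x ∷_) (initial-lookupOr d xs)

∈-initial : (p : ℕ → A) → ∀ {i m} → i < m → p i Vec.∈ initial p m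
∈-initial p {zero}  {suc m} _         = VecAny.here refl
∈-initial p {suc i} {suc m} (s≤s i<m) = VecAny.there (∈-initial (p ∘ suc) i<m)

IsPath : List (Vec (Fin n) m) → ℕ → (ℕ → Fin n) → Set
IsPath {m = m} E s p = Vec.Unique (initial p s) ×
                       (∀ i → i + m ≤ₙ s → initial (λ j → p (i + j)) m ∈ E)

module _ {n m t : ℕ} {H : List (Vec (Fin n) (suc m))} (closed : Closed H) (simple : Unique H)
         (inj : ∀ {e} → e ∈ H → Vec.Unique e)
         (deg : ∀ {e} → e ∈ H → t < length (withTail (Vec.tail e) H)) where

  private
    -- The induction invariant: the first `m` vertices are the tail of an edge in `H`, so `deg`
    -- offers more than `t` edges that might prolong the path at the front.
    Extendable : (ℕ → Fin n) → Set
    Extendable p = ∃[ v ] v ∷ initial p m ∈ H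

  -- By `inj`, the head of an edge with tail `initial p m` avoids the first `m` vertices, so it can
  -- only clash with one of the other `l`. This blocks at most `l ≤ t` edges, fewer than there are
  -- candidates.
  extendPath : ∀ l → l ≤ₙ t → ∀ {p} → IsPath H (l + m) p → Extendable p →
               ∃[ p′ ] IsPath H (suc l + m) p′ × Extendable p′
  extendPath l l≤t {p} (pu , windows) (_ , ext) =
    push v p , (VecAll.tabulate⁺ fresh VecAllPairs.∷ pu , windows′) , push v p m , extendable
    where
    tail? = λ (e : Vec (Fin n) (suc m)) → Vec.tail e ≟ᵥ initial p m
    candidates blocked : List (Vec (Fin n) (suc m))
    candidates = withTail (initial p m) H
    blocked    = List.applyUpTo (λ i → p (i + m) ∷ initial p m) l

    new : Any (_∉ blocked) candidates
    new = decidable-stable (Any.any? (λ e → ¬? (e ∈? blocked)) candidates) λ ¬new →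
      ℕ.<⇒≱ (deg ext) (begin
        length candidates
          ≤⟨ unique-⊆⇒length≤ (Unique.filter⁺ tail? simple)
               (λ {e} e∈ → decidable-stable (e ∈? blocked) λ e∉ → ¬new (lose e∈ e∉)) ⟩
        length blocked      ≡⟨ List.length-applyUpTo _ l ⟩
        l                   ≤⟨ l≤t ⟩
        t                   ∎)
      where open ℕ.≤-Reasoning

    v : Fin n
    v = Vec.head (proj₁ (find new))

    v∷≡ : proj₁ (find new) ≡ v ∷ initial p m
    v∷≡ with _ ∷ _ , e∈ , _ ← find new = cong (_ ∷_) (proj₂ (∈-filter⁻ tail? {xs = H} e∈))

    v∷∈ : v ∷ initial p m ∈ H
    v∷∈ = subst (_∈ H) v∷≡ (proj₁ (∈-filter⁻ tail? {xs = H} (proj₁ (proj₂ (find new)))))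

    v∷∉ : v ∷ initial p m ∉ blocked
    v∷∉ = subst (_∉ blocked) v∷≡ (proj₂ (proj₂ (find new)))

    fresh : (i : Fin (l + m)) → v ≢ p (toℕ i)
    fresh i v≡ with toℕ i ℕ.<? m
    ... | yes i<m = VecAll.lookup (VecAllPairs.head (inj v∷∈)) (∈-initial p i<m) v≡
    ... | no  i≮m = v∷∉ (subst (_∈ blocked) (cong (_∷ initial p m) eq)
                      (∈-applyUpTo⁺ _ (ℕ.+-cancelʳ-< m _ _ (subst (_< l + m) (sym i≡) (Fin.toℕ<n i)))))
      where
      i≡ : toℕ i ∸ m + m ≡ toℕ i
      i≡ = ℕ.m∸n+n≡m (ℕ.≮⇒≥ i≮m)
      eq : p (toℕ i ∸ m + m) ≡ v
      eq = trans (cong p i≡) (sym v≡)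

    windows′ : ∀ i → i + suc m ≤ₙ suc (l + m) → initial (λ j → push v p (i + j)) (suc m) ∈ H
    windows′ zero    _       = v∷∈
    windows′ (suc i) (s≤s h) = windows i h

    -- The new edge lists the first `suc m` vertices of the new path. Moving its last entry to the
    -- front is a rotation, so `closed` makes the first `m` vertices a tail again.
    extendable : push v p m ∷ initial (push v p) m ∈ H
    extendable = closed v∷∈ (subst (e ∈_) (cong rotations (sym (initial-∷ʳ (push v p) m)))
      (∈-rotations-sym e (∈-rotations-step e (here refl))))
      where e = push v p m ∷ initial (push v p) m

  -- Starts from the tail of an edge, a path on `m` vertices that is too short for a window, and
  -- prolongs it up to `suc t` times, each time from some `l ≤ t`.
  longPath : ∀ {e} → e ∈ H → ∀ l → l ≤ₙ suc t → ∃[ p ] IsPath H (l + m) p × Extendable p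
  longPath {v ∷ x} e∈ zero _ =
      -- The default `v` fills only the positions from `m` on, which lie outside the path.
      lookupOr v x
    , (subst Vec.Unique (sym x≡) (VecAllPairs.tail (inj e∈))
      , λ i h → contradiction (ℕ.≤-trans (ℕ.m≤n+m (suc m) i) h) ℕ.1+n≰n)
    , v , subst (λ x → v ∷ x ∈ H) (sym x≡) e∈
    where
    x≡ : initial (lookupOr v x) m ≡ x
    x≡ = initial-lookupOr v x
  longPath e∈ (suc l) (s≤s l≤t) =
    let p , path , ext = longPath e∈ l (ℕ.m≤n⇒m≤1+n l≤t) in extendPath l l≤t {p} path ext

-- Tournaments

isPath⇒contains : ∀ {s p} (G : Digraph (suc m) n) → IsPath (edges G) s p → G Contains tightPath (suc m) s
isPath⇒contains {m} {n} {s} {p} G (u , windows) =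
    p ∘ toℕ
  , (λ {i} {j} eq → VecUnique.lookup-injective u i j
      (trans (Vec.lookup∘tabulate _ i) (trans eq (sym (Vec.lookup∘tabulate _ j)))))
  , λ e∈ → case ∈-tabulate⁻ e∈ of λ where
      (i , refl) → subst (_∈ edges G) (window-initial i) (windows (toℕ i) (bound i))
  where
  bound : (i : Fin (suc s ∸ suc m)) → toℕ i + suc m ≤ₙ s
  -- `window-bound` at the last index of the window says `i + m < s`, which is the claim up to
  -- moving a `suc`.
  bound i = subst (_≤ₙ s)
    (trans (cong (λ j → suc (toℕ i + j)) (Fin.toℕ-fromℕ m)) (sym (ℕ.+-suc (toℕ i) m)))
    (window-bound (suc m) s i (Fin.fromℕ m))
  window-initial : ∀ i → initial (λ j → p (toℕ i + j)) (suc m) ≡ Vec.map (p ∘ toℕ) (window (suc m) s i)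
  window-initial i = trans
    (Vec.tabulate-cong {n = suc m} λ j → cong p (sym (Fin.toℕ-fromℕ< (window-bound (suc m) s i j))))
    (Vec.tabulate-∘ (p ∘ toℕ) λ j → fromℕ< (window-bound (suc m) s i j))

-- With r = q + 1 the hypothesis says k = r! - (r - 1)! + 1, written as a sum to keep clear of
-- truncated subtraction.
module _ {q k : ℕ} (k+q!≡ : k + q ! ≡ suc (suc q !)) (G : Digraph (suc q) n) (isT : IsTournament k G) where

  private
    E : List (Vec (Fin n) (suc q))
    E = edges G

  AllRotations : Vec (Fin n) (suc q) → Set
  AllRotations e = All (_∈ E) (rotations e)

  allRotations? : ∀ e → Dec (AllRotations e)
  allRotations? e = All.all? (_∈? E) (rotations e)

  cyclicEdges : List (Vec (Fin n) (suc q))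
  cyclicEdges = filter allRotations? E

  ∈-cyclicEdges : ∀ {e} → AllRotations e → e ∈ cyclicEdges
  ∈-cyclicEdges all = ∈-filter⁺ allRotations? (All.lookup all (here refl)) all

  cyclicEdges-unique : Unique cyclicEdges
  cyclicEdges-unique = Unique.filter⁺ allRotations? (simple G)

  cyclicEdges⊆E : ∀ {e} → e ∈ cyclicEdges → e ∈ E
  cyclicEdges⊆E = proj₁ ∘ ∈-filter⁻ allRotations? {xs = E}

  cyclicEdges-closed : Closed cyclicEdges
  cyclicEdges-closed {e} e∈ e′∈ = ∈-cyclicEdges (All.tabulate λ e″∈ →
    All.lookup (proj₂ (∈-filter⁻ allRotations? {xs = E} e∈)) (∈-rotations-trans e e″∈ e′∈))

  -- One more than `q` edges for each of the `q !` cyclic orders; the surplus edge drives the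
  -- pigeonhole argument in `cyclicOrder`.
  k≡ : k ≡ suc (q ! * q)
  k≡ = ℕ.+-cancelʳ-≡ (q !) k _ (trans k+q!≡ (cong suc
    (trans (ℕ.+-comm (q !) (q * q !)) (cong (_+ q !) (ℕ.*-comm q (q !))))))

  -- The (r − 1)! cyclic orders of a set share r! − (r − 1)! + 1 edges, so one of them has all r.

  cyclicOrder : ∀ {v xs} → Vec.Unique (v ∷ xs) → Any (λ ys → v ∷ ys ∈ cyclicEdges) (permutations xs)
  cyclicOrder {v} {xs} u@(v∉ VecAllPairs.∷ uxs) = Any.map ∈-cyclicEdges
    (decidable-stable (Any.any? (λ ys → allRotations? (v ∷ ys)) (permutations xs)) λ none →
      ℕ.1+n≰n (begin
        suc (q ! * q)          ≡⟨ k≡ ⟨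
        k                      ≡⟨ isT S (unique⇒full-support u) ⟨
        length (edgesOn G S)   ≤⟨ unique-⊆⇒length≤ (Unique.filter⁺ S? (simple G)) cover ⟩
        length (concatMap edgesAmong (permutations xs))
          ≤⟨ length-concatMap-≤ edgesAmong (permutations xs) (λ {ys} ys∈ → s≤s⁻¹ (ℕ.≤-trans
               (List.filter-notAll (_∈? E) (rotations (v ∷ ys))
                 (All.¬All⇒Any¬ (_∈? E) _ λ all → none (lose ys∈ all)))
               (ℕ.≤-reflexive (List.length-iterate rotate (v ∷ ys) (suc q))))) ⟩
        length (permutations xs) * q   ≡⟨ cong (_* q) (length-permutations xs) ⟩
        q ! * q                        ∎))
    where
    open ℕ.≤-Reasoning
    S : Subset n
    S = support (v ∷ xs)
    S? = λ (e : Vec (Fin n) (suc q)) → support e ≟ₛ S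
    edgesAmong : Vec (Fin n) q → List (Vec (Fin n) (suc q))
    edgesAmong ys = filter (_∈? E) (rotations (v ∷ ys))
    -- Orderings with `v` in front represent the cyclic orders: each edge on `S` rotates to one, and
    -- its remaining entries permute `xs`.
    cover : ∀ {e} → e ∈ edgesOn G S → e ∈ concatMap edgesAmong (permutations xs)
    cover {e} e∈ with e∈E , eq ← ∈-filter⁻ S? {xs = E} e∈
      with ys , v∷ys∈ ← rotate-to-front e (subst (v ∈ₛ_) (sym eq) (Subset.x∈p∪q⁺ (inj₁ (Subset.x∈⁅x⁆ v))))
      with eq′ ← trans (support-rotations v∷ys∈) eq
      with v∉ys VecAllPairs.∷ _ ← unique-support {vs = v ∷ xs} {ws = v ∷ ys} eq′ u =
      ∈-concatMap⁺ edgesAmong (lose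
        (∈-permutations uxs (⁅x⁆∪-cancel (∉-support⁻ v∉ys) (∉-support⁻ v∉) eq′))
        (∈-filter⁺ (_∈? E) (∈-rotations-sym e v∷ys∈) e∈E))

  -- For each injective tuple, `cyclicOrder` finds a cyclic edge on the same set with the same first
  -- vertex; one of the `q !` rearrangements of its tail recovers the tuple.
  length-injections≤ : length (injections (suc q) n) ≤ₙ length cyclicEdges * q !
  length-injections≤ = ℕ.≤-trans (unique-⊆⇒length≤ (injections-unique (suc q) n) cover)
    (length-concatMap-≤ reorderings cyclicEdges λ { {v ∷ xs} _ → ℕ.≤-reflexive
      (trans (List.length-map (v ∷_) (permutations xs)) (length-permutations xs)) })
    where
    reorderings : Vec (Fin n) (suc q) → List (Vec (Fin n) (suc q))
    reorderings (v ∷ xs) = List.map (v ∷_) (permutations xs)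
    cover : ∀ {e} → e ∈ injections (suc q) n → e ∈ concatMap reorderings cyclicEdges
    cover {v ∷ xs} e∈ with u@(v∉ VecAllPairs.∷ _) ← ∈-injections⁻ e∈
      with ys , ys∈ , v∷ys∈ ← find (cyclicOrder u)
      with eq ← permutations-support xs ys∈ =
      ∈-concatMap⁺ reorderings (lose v∷ys∈ (∈-map⁺ (v ∷_)
        (∈-permutations (unique-support {vs = xs} {ws = ys} eq (VecAllPairs.tail u)) (sym eq))))

  containsLongPath : ∀ t → t * suc q ! < n ∸ q → G Contains tightPath (suc q) (suc t + q)
  containsLongPath t small = isPath⇒contains {p = proj₁ path} G
    (proj₁ (proj₁ (proj₂ path)) , λ i h → ⊆E (proj₂ (proj₁ (proj₂ path)) i h))
    where
    tails : List (Vec (Fin n) q)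
    tails = injections q n
    q≤n : q ≤ₙ n
    q≤n = ℕ.<⇒≤ (ℕ.m∸n≢0⇒n<m λ eq → ℕ.n≮0 (subst (t * suc q ! <_) eq small))
    -- Both sides are compared after multiplication by `q !`, which turns t r q! into t r! so that
    -- `small` applies. The strict step needs at least one tail, hence `q≤n`.
    big : t * suc q * length tails < length cyclicEdges
    big = ℕ.*-cancelʳ-< (q !) _ _ (begin-strict
      t * suc q * length tails * q !       ≡⟨ ℕ.*-assoc (t * suc q) (length tails) (q !) ⟩
      t * suc q * (length tails * q !)     ≡⟨ cong (t * suc q *_) (ℕ.*-comm (length tails) (q !)) ⟩
      t * suc q * (q ! * length tails)     ≡⟨ ℕ.*-assoc (t * suc q) (q !) (length tails) ⟨
      t * suc q * q ! * length tails       ≡⟨ cong (_* length tails) (ℕ.*-assoc t (suc q) (q !)) ⟩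
      t * suc q ! * length tails
        <⟨ ℕ.*-monoˡ-< (length tails) {{>-nonZero (length-injections-pos q n q≤n)}} small ⟩
      (n ∸ q) * length tails               ≤⟨ length-injections-suc q n ⟩
      length (injections (suc q) n)    ≤⟨ length-injections≤ ⟩
      length cyclicEdges * q !         ∎)
      where open ℕ.≤-Reasoning
    pruned = prune t (length tails) tails cyclicEdges refl cyclicEdges-unique cyclicEdges-closed
      (λ { {v ∷ x} e∈ → ∈-injections⁺ (VecAllPairs.tail (All.lookup (distinct G) (cyclicEdges⊆E e∈))) })
      big
    H : List (Vec (Fin n) (suc q))
    H = proj₁ pruned
    ⊆E : ∀ {e} → e ∈ H → e ∈ E
    ⊆E = let _ , _ , _ , ⊆cyclic , _ = pruned in cyclicEdges⊆E ∘ ⊆cyclic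
    path = let _ , u , c , _ , pos , deg = pruned in
      longPath c u (All.lookup (distinct G) ∘ ⊆E) deg (∈-lookup {xs = H} (fromℕ< pos)) (suc t) ℕ.≤-refl

-- The lower bound for `f`

everyTournamentContainsLongPath : ∀ n q k t .{{_ : NonZero n}} → k + q ! ≡ suc (suc q !) →
  t * suc q ! < n ∸ q → EveryTournamentContainsPath n (suc q) k (suc t + q)
everyTournamentContainsLongPath n q k t eq small G isT = containsLongPath {q = q} eq G isT t small

-- A path on one vertex has no windows when r > 1.

containsVertex : ∀ n q k .{{_ : NonZero q}} .{{_ : NonZero n}} → EveryTournamentContainsPath n (suc q) k 1
containsVertex (suc n) (suc q) k G _ =
  isPath⇒contains {s = 1} {p = λ _ → Fin.zero} G
    ( VecAll.[] VecAllPairs.∷ VecAllPairs.[]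
    , λ i h → contradiction (ℕ.≤-trans (ℕ.m≤n+m (suc (suc q)) i) h) λ { (s≤s ()) } )

k≤[1+q]! : ∀ {q k} → k + q ! ≡ suc (suc q !) → k ≤ₙ suc q !
k≤[1+q]! {q} {k} eq = s≤s⁻¹ (begin
  suc k          ≡⟨ ℕ.+-comm 1 k ⟩
  k + 1          ≤⟨ ℕ.+-monoʳ-≤ k (ℕ.1≤n! q) ⟩
  k + q !        ≡⟨ eq ⟩
  suc (suc q !)  ∎)
  where open ℕ.≤-Reasoning

f-lower-bound : ∀ n q k .{{_ : NonZero n}} → k + q ! ≡ suc (suc q !) → n ≤ₙ f n (suc q) k * suc q !
f-lower-bound n q k eq with ℕ.<-≤-connex q n
... | inj₁ q<n = begin
  n                              ≡⟨ ℕ.m∸n+n≡m (ℕ.<⇒≤ q<n) ⟨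
  n ∸ q + q                      ≡⟨ cong (_+ q) n∸q≡ ⟨
  suc d + q                      ≤⟨ ℕ.+-mono-≤ d<  (ℕ.m≤m*n q (suc q !)) ⟩
  suc t * suc q ! + q * suc q !  ≡⟨ ℕ.*-distribʳ-+ (suc q !) (suc t) q ⟨
  (suc t + q) * suc q !
    ≤⟨ ℕ.*-monoˡ-≤ (suc q !) (proj₂ (f-isMaximum n (suc q) k (k≤[1+q]! {q} eq))
         (everyTournamentContainsLongPath n q k t eq small)) ⟩
  f n (suc q) k * suc q !        ∎
  where
  open ℕ.≤-Reasoning
  instance _ = suc q !≢0
  -- The quotient `t` is the largest number with t r! < n - q; the predecessor `d` turns this strict
  -- inequality into a weak one.
  d t : ℕ
  d = pred (n ∸ q)
  t = d ℕ./ (suc q !)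
  n∸q≡ : suc d ≡ n ∸ q
  n∸q≡ = ℕ.suc-pred (n ∸ q) {{>-nonZero (ℕ.m<n⇒0<n∸m q<n)}}
  d< : d < suc t * suc q !
  d< = ℕ.≤-trans (s≤s (ℕ.≤-reflexive (m≡m%n+[m/n]*n d (suc q !))))
    (ℕ.+-monoˡ-≤ (t * suc q !) (m%n<n d (suc q !)))
  small : t * suc q ! < n ∸ q
  small = subst (t * suc q ! <_) n∸q≡ (s≤s (m/n*n≤m d (suc q !)))
-- Here n ≤ r!, so a single vertex is enough; `q` is positive because `n` is.
... | inj₂ n≤q = begin
  n                          ≤⟨ n≤q ⟩
  q                          ≤⟨ ℕ.n≤1+n q ⟩
  suc q                      ≤⟨ ℕ.m≤m*n (suc q) (q !) {{q !≢0}} ⟩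
  suc q !                    ≡⟨ ℕ.*-identityˡ (suc q !) ⟨
  1 * suc q !                ≤⟨ ℕ.*-monoˡ-≤ (suc q !) (proj₂ (f-isMaximum n (suc q) k (k≤[1+q]! {q} eq))
                                  (containsVertex n q k {{>-nonZero (ℕ.<-≤-trans (>-nonZero⁻¹ n) n≤q)}})) ⟩
  f n (suc q) k * suc q !    ∎
  where open ℕ.≤-Reasoning

-- Rational arithmetic

-- `_/_` reduces to lowest terms; on unnormalised rationals, equalities and inequalities become
-- cross-multiplications of integers.
toℚᵘ-/ : ∀ i d .{{_ : NonZero d}} → toℚᵘ (i / d) ℚᵘ.≃ i ℚᵘ./ d
toℚᵘ-/ i (suc d) = ℚ.toℚᵘ-fromℚᵘ (mkℚᵘ i d)

/1-homo-+ : ∀ a b → + (a + b) / 1 ≡ + a / 1 ℚ.+ + b / 1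
/1-homo-+ a b = ℚ.toℚᵘ-injective (begin
  toℚᵘ (+ (a + b) / 1)                  ≈⟨ toℚᵘ-/ (+ (a + b)) 1 ⟩
  + (a + b) ℚᵘ./ 1
    ≈⟨ *≡* (cong (ℤ._* + 1) (sym (cong₂ ℤ._+_ (ℤ.*-identityʳ (+ a)) (ℤ.*-identityʳ (+ b))))) ⟩
  + a ℚᵘ./ 1 ℚᵘ.+ + b ℚᵘ./ 1            ≈⟨ ℚᵘ.+-cong (toℚᵘ-/ (+ a) 1) (toℚᵘ-/ (+ b) 1) ⟨
  toℚᵘ (+ a / 1) ℚᵘ.+ toℚᵘ (+ b / 1)    ≈⟨ ℚ.toℚᵘ-homo-+ (+ a / 1) (+ b / 1) ⟨
  toℚᵘ (+ a / 1 ℚ.+ + b / 1)            ∎)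
  where open ℚᵘ.≃-Reasoning

1/d*n≡n/d : ∀ n d .{{_ : NonZero d}} → + 1 / d ℚ.* (+ n / 1) ≡ + n / d
1/d*n≡n/d n d@(suc _) = ℚ.toℚᵘ-injective (begin
  toℚᵘ (+ 1 / d ℚ.* (+ n / 1))          ≈⟨ ℚ.toℚᵘ-homo-* (+ 1 / d) (+ n / 1) ⟩
  toℚᵘ (+ 1 / d) ℚᵘ.* toℚᵘ (+ n / 1)    ≈⟨ ℚᵘ.*-cong (toℚᵘ-/ (+ 1) d) (toℚᵘ-/ (+ n) 1) ⟩
  + 1 ℚᵘ./ d ℚᵘ.* (+ n ℚᵘ./ 1)
    ≈⟨ *≡* (cong₂ ℤ._*_ (ℤ.*-identityˡ (+ n)) (cong +_ (sym (ℕ.*-identityʳ d)))) ⟩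
  + n ℚᵘ./ d                            ≈⟨ toℚᵘ-/ (+ n) d ⟨
  toℚᵘ (+ n / d)                        ∎)
  where open ℚᵘ.≃-Reasoning

d*m/d≡m : ∀ d m .{{_ : NonZero d}} → + (d * m) / d ≡ + m / 1
d*m/d≡m d@(suc _) m = ℚ.toℚᵘ-injective (begin
  toℚᵘ (+ (d * m) / d)   ≈⟨ toℚᵘ-/ (+ (d * m)) d ⟩
  + (d * m) ℚᵘ./ d
    ≈⟨ *≡* (trans (ℤ.*-identityʳ _) (trans (cong +_ (ℕ.*-comm d m)) (ℤ.pos-* m d))) ⟩
  + m ℚᵘ./ 1             ≈⟨ toℚᵘ-/ (+ m) 1 ⟨
  toℚᵘ (+ m / 1)         ∎)
  where open ℚᵘ.≃-Reasoning

n≤a*d⇒n/d≤a : ∀ {n} a d .{{_ : NonZero d}} → n ≤ₙ a * d → + n / d ≤ + a / 1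
n≤a*d⇒n/d≤a {n} a d@(suc _) n≤ = ℚ.toℚᵘ-cancel-≤ (begin
  toℚᵘ (+ n / d)   ≃⟨ toℚᵘ-/ (+ n) d ⟩
  + n ℚᵘ./ d
    ≤⟨ *≤* (subst₂ ℤ._≤_ (sym (ℤ.*-identityʳ (+ n))) (ℤ.pos-* a d) (ℤ.+≤+ n≤)) ⟩
  + a ℚᵘ./ 1       ≃⟨ toℚᵘ-/ (+ a) 1 ⟨
  toℚᵘ (+ a / 1)   ∎)
  where open ℚᵘ.≤-Reasoning

/1-mono-≤ : ∀ {a b} → a ≤ₙ b → + a / 1 ≤ + b / 1
/1-mono-≤ {b = b} a≤b = n≤a*d⇒n/d≤a b 1 (subst (_ ≤ₙ_) (sym (ℕ.*-identityʳ b)) a≤b)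

/1-injective : ∀ {a b} → + a / 1 ≡ + b / 1 → a ≡ b
/1-injective {a} {b} eq with *≡* eq′ ← ℚ./-injective-≃ (mkℚᵘ (+ a) 0) (mkℚᵘ (+ b) 0) eq =
  ℤ.+-injective (ℤ.*-cancelʳ-≡ (+ a) (+ b) (+ 1) eq′)

-- By r!/r = q! and r! - q! = q · q!.
[1-1/r+1/r!]r!≡ : ∀ q → [1-1/r+1/r!]r! (suc q) ≡ + suc (q * q !) / 1
[1-1/r+1/r!]r!≡ q = begin
  (1ℚ ℚ.- a ℚ.+ b) ℚ.* R          ≡⟨ expand a b R ⟩
  R ℚ.- a ℚ.* R ℚ.+ b ℚ.* R
    ≡⟨ cong₂ (λ x y → R ℚ.- x ℚ.+ y)
         (trans (1/d*n≡n/d (suc q !) (suc q)) (d*m/d≡m (suc q) (q !)))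
         (trans (1/d*n≡n/d (suc q !) (suc q !))
           (trans (cong (λ m → + m / (suc q !)) (sym (ℕ.*-identityʳ (suc q !)))) (d*m/d≡m (suc q !) 1))) ⟩
  R ℚ.- Q ℚ.+ 1ℚ                  ≡⟨ cong (λ x → x ℚ.- Q ℚ.+ 1ℚ) (/1-homo-+ (q !) (q * q !)) ⟩
  Q ℚ.+ X ℚ.- Q ℚ.+ 1ℚ            ≡⟨ collapse Q X ⟩
  1ℚ ℚ.+ X                        ≡⟨ /1-homo-+ 1 (q * q !) ⟨
  + suc (q * q !) / 1             ∎
  where
  open ≡-Reasoning
  open +-*-Solver
  instance _ = suc q !≢0
  a b R Q X : ℚ
  a = + 1 / suc q
  b = + 1 / suc q !
  R = + (suc q !) / 1
  Q = + (q !) / 1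
  X = + (q * q !) / 1
  expand : ∀ a b R → (1ℚ ℚ.- a ℚ.+ b) ℚ.* R ≡ R ℚ.- a ℚ.* R ℚ.+ b ℚ.* R
  expand = solve 3 (λ a b R → (con 1ℚ :- a :+ b) :* R := R :- a :* R :+ b :* R) refl
  collapse : ∀ Q X → Q ℚ.+ X ℚ.- Q ℚ.+ 1ℚ ≡ 1ℚ ℚ.+ X
  collapse = solve 2 (λ Q X → Q :+ X :- Q :+ con 1ℚ := con 1ℚ :+ X) refl

-- The linear path threshold

-- Without a minimum, strong induction refutes `P` everywhere, since a member with no smaller member
-- would be a minimum. The double negation stands in for deciding `P`.
¬¬-minimum : {P : Pred ℕ 0ℓ} → ∃ P → ¬ ¬ (∃ (IsMinimum P))
¬¬-minimum {P} (k , pk) none = ℕ.<-rec (λ k → ¬ P k)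
  (λ k below pk → none (k , pk , λ {i} pi → ℕ.≮⇒≥ λ i<k → below i<k pi)) k pk

theorem18 : (r : ℕ) .{{_ : NonZero r}} →
    ((n : ℕ) .{{_ : NonZero n}} (k : ℕ) →
    (+ k / 1) ≡ [1-1/r+1/r!]r! r →
    ((+ n / (r !)) {{r !≢0}}) ≤ (+ f n r k / 1))
    × (¬ ¬ (∃ (IsLinearPathThreshold r)))
    × ((t : ℕ) → IsLinearPathThreshold r t → (+ t / 1) ≤ [1-1/r+1/r!]r! r)
theorem18 (suc q) = bound , ¬¬-minimum (k₀ , linear) , λ t (_ , minimal) →
  subst (+ t / 1 ≤_) (sym ([1-1/r+1/r!]r!≡ q)) (/1-mono-≤ (minimal linear))
  where
  instance _ = suc q !≢0
  k₀ : ℕ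
  k₀ = suc (q * q !)
  k₀+q!≡ : k₀ + q ! ≡ suc (suc q !)
  k₀+q!≡ = cong suc (ℕ.+-comm (q * q !) (q !))
  bound : (n : ℕ) .{{_ : NonZero n}} (k : ℕ) → + k / 1 ≡ [1-1/r+1/r!]r! (suc q) →
          + n / (suc q !) ≤ + f n (suc q) k / 1
  bound n k eq = n≤a*d⇒n/d≤a (f n (suc q) k) (suc q !) (f-lower-bound n q k
    (trans (cong (_+ q !) (/1-injective (trans eq ([1-1/r+1/r!]r!≡ q)))) k₀+q!≡))
  linear : k₀ ≤ₙ suc q ! × IsLinear λ n → f n (suc q) k₀
  -- The slope is 1/r!, valid from `N = 1` on because `bound` speaks of positive `n`.
  linear = k≤[1+q]! {q} k₀+q!≡ , + 1 / (suc q !) ,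
    ℚ.positive⁻¹ (+ 1 / (suc q !)) {{ℚ.normalize-pos 1 (suc q !)}} , 1 , λ n 1≤n →
      subst (_≤ + f n (suc q) k₀ / 1) (sym (1/d*n≡n/d n (suc q !)))
        (bound n {{>-nonZero 1≤n}} k₀ (sym ([1-1/r+1/r!]r!≡ q)))
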